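{- For every integer $n\geq 0$, \begin{align*} \overline{p}_{ -7}(8n+1) &\equiv 0 \pmod{2}, & \overline{p}_{ -7}(8n+2) &\equiv 0 \pmod{16}, & \overline{p}_{ -7}(8n+3) &\equiv 0 \pmod{32}, \\ \overline{p}_{ -7}(8n+4) &\equiv 0 \pmod{2}, & \overline{p}_{ -7}(8n+7) &\equiv 0 \pmod{128}. \end{align*}
   Context: For $|q|<1$ let $(a;q)_\infty=\prod_{i\geq 0}(1-aq^i)$. For a positive integer $t$, the number $\overline{p}_{ -t}(n)$ of $t$-colored overpartitions of $n$ is defined by the generating function \[ \sum_{n\geq 0}\overline{p}_{ -t}(n)q^n=\frac{(q^2;q^2)_\infty^t}{(q;q)_\infty^{2t}}. \] -}

module Defs where

open import Data.Nat as ℕ using (ℕ; zero; suc)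
open import Data.Integer using (ℤ; +_; _+_; _*_; -_; _-_)
open import Data.List using (List; []; _∷_; upTo; sum; map)

Series : Set
Series = ℕ → ℤ

sumTo : ℕ → (ℕ → ℤ) → ℤ
sumTo zero    f = f zero
sumTo (suc n) f = sumTo n f + f (suc n)

_⊗_ : Series → Series → Series
(a ⊗ b) n = sumTo n (λ k → a k * b (n ℕ.∸ k))

one : Series
one zero    = + 1
one (suc _) = + 0

pow : Series → ℕ → Series
pow a zero    = one
pow a (suc t) = a ⊗ pow a t

oneMinusQ^ : ℕ → Series

oneMinusQ^ m n = helper n m
  where
  eqb : ℕ → ℕ → ℤ
  eqb zero    zero    = + 1
  eqb zero    (suc _) = + 0
  eqb (suc _) zero    = + 0
  eqb (suc x) (suc y) = eqb x y
  helper : ℕ → ℕ → ℤ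
  helper x y = eqb x 0 - eqb x y

finProd : ℕ → ℕ → Series
finProd k zero    = one
finProd k (suc N) = oneMinusQ^ (k ℕ.* suc N) ⊗ finProd k N

-- (q^k;q^k)_∞ for k ≥ 1: the coefficient of q^n only depends on the factors
-- with k·i ≤ n, so it equals the coefficient of the finite product up to i = n.
-- qPochSuc k = (q^{k+1};q^{k+1})_∞
qPochSuc : ℕ → Series
qPochSuc k n = finProd (suc k) n n

-- multiplicative inverse of a series with constant term 1:
-- b 0 = 1,  b n = - Σ_{j=1}^{n} a j * b (n - j)
-- defined by well-founded recursion through a list of previous values
private
  invUpTo : Series → ℕ → List ℤ
  invUpTo a zero    = + 1 ∷ []
  invUpTo a (suc n) = next ∷ prev
    where
    prev = invUpTo a n
    -- prev = [b n, ..., b 0]; pair a (j) with b (n+1-j) for j = 1..n+1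
    go : ℕ → List ℤ → ℤ
    go j []       = + 0
    go j (x ∷ xs) = a j * x + go (suc j) xs
    next = - go 1 prev

  headOr0 : List ℤ → ℤ
  headOr0 []      = + 0
  headOr0 (x ∷ _) = x

inv : Series → Series
inv a n = headOr0 (invUpTo a n)

-- t-colored overpartitions:  Σ p̄_{-t}(n) q^n = (q²;q²)^t_∞ / (q;q)^{2t}_∞
pbar : ℕ → ℕ → ℤ
pbar t = pow (qPochSuc 1) t ⊗ inv (pow (qPochSuc 0) (2 ℕ.* t))

{-# OPTIONS --safe #-}
-- Write φ(-q) = (q;q)²_∞/(q²;q²)_∞, so that the generating function of p̄₋₇ is φ(-q)⁻⁷.  Gauss's
-- identity φ(-q) = 1 + 2s with s = Σ_{k≥1} (-1)^k q^{k²} comes from Shanks' telescoping identity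
--   (-q;q)_n (1 + 2 Σ_{k=1}^n (-1)^k q^{k²}) = Σ_{k=0}^n (-1)^k E_{n,k} q^{k(n+1)},
-- in which E_{n,0} = (q;q)_n and E_{n,k} = 2 (-q;q)_{k-1} (q^{k+1};q)_{n-k} for k ≥ 1, so that the
-- right-hand side is (q;q)_n modulo q^{n+1}.  Consequently, modulo 128,
--   Σ p̄₋₇(n) q^n = 1 - 14s - 16s² - 32s³ + 32s⁴ + 64s⁵.
-- Split s = o + e, where o collects the odd squares (exponents ≡ 1 mod 8) and e the even ones
-- (exponents ≡ 0 mod 4).  In degrees ≡ 3 mod 4 only the terms oⁱeʲ with i ≡ 3 mod 4 of a power of s
-- contribute: none for s and s², o³ for s³ (which lives in degrees ≡ 3 mod 8), 4o³e for s⁴ and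
-- 10o³e² for s⁵.
module Submission where

open import Defs
open import Algebra.Bundles using (CommutativeRing)
import Algebra.Properties.Semiring.Exp
import Algebra.Solver.Ring
open import Algebra.Solver.Ring.AlmostCommutativeRing
  using (fromCommutativeRing; _-Raw-AlmostCommutative⟶_)
open import Algebra.Structures using (IsCommutativeRing)
open import Data.Empty using (⊥-elim)
open import Data.Fin using (zero)
open import Data.Integer using (+_)
open import Data.Integer as ℤ using (ℤ; 0ℤ; 1ℤ)
open import Data.Integer.Divisibility using (_∣_)
open import Data.Integer.Divisibility.Signed using (divides; ∣⇒∣ᵤ)
import Data.Integer.Properties as ℤ
open import Data.Integer.Solver using (module +-*-Solver)
import Data.Maybe as Maybe
open import Data.Nat using (ℕ; zero; suc; _+_; _*_; _∸_; _≤_; _<_; _%_; NonZero; z≤n; s≤s)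
import Data.Nat.Divisibility as ℕ∣
open import Data.Nat.DivMod using (%-distribˡ-+; [m+kn]%n≡m%n; m∣n⇒o%n%m≡o%m)
import Data.Nat.Properties as ℕ
open import Data.Nat.Solver using () renaming (module +-*-Solver to ℕ-Solver)
open import Data.Product using (_×_; _,_; ∃; ∃₂; map; map₂)
open import Data.Sum using (_⊎_; inj₁; inj₂)
open import Data.Vec using ([]; _∷_)
open import Function using (_∘_)
open import Relation.Binary.PropositionalEquality
  using (_≡_; _≢_; refl; sym; trans; cong; cong₂; subst; module ≡-Reasoning)
import Relation.Binary.Reasoning.Setoid
open import Relation.Nullary using (yes; no; contradiction)
open import Relation.Nullary.Decidable using (dec⇒maybe)

-- Sums over initial segments of ℕ

sumTo-cong : ∀ n {f g : Series} → (∀ k → k ≤ n → f k ≡ g k) → sumTo n f ≡ sumTo n g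
sumTo-cong zero    f≗g = f≗g 0 z≤n
sumTo-cong (suc n) f≗g =
  cong₂ ℤ._+_ (sumTo-cong n λ k → f≗g k ∘ ℕ.m≤n⇒m≤1+n) (f≗g (suc n) ℕ.≤-refl)

sumTo-zero : ∀ n {f : Series} → (∀ k → k ≤ n → f k ≡ 0ℤ) → sumTo n f ≡ 0ℤ
sumTo-zero n {f} f≗0 = trans (sumTo-cong n f≗0) (const-zero n)
  where
  const-zero : ∀ n → sumTo n (λ _ → 0ℤ) ≡ 0ℤ
  const-zero zero    = refl
  const-zero (suc n) = cong (ℤ._+ 0ℤ) (const-zero n)

sumTo-+ : ∀ n (f g : Series) → sumTo n (λ k → f k ℤ.+ g k) ≡ sumTo n f ℤ.+ sumTo n g
sumTo-+ zero    f g = refl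
sumTo-+ (suc n) f g = trans (cong (ℤ._+ (f (suc n) ℤ.+ g (suc n))) (sumTo-+ n f g))
  (solve 4 (λ a b c d → (a :+ b) :+ (c :+ d) := (a :+ c) :+ (b :+ d)) refl
    (sumTo n f) (sumTo n g) (f (suc n)) (g (suc n)))
  where open +-*-Solver

sumTo-*ˡ : ∀ n c (f : Series) → sumTo n (λ k → c ℤ.* f k) ≡ c ℤ.* sumTo n f
sumTo-*ˡ zero    c f = refl
sumTo-*ˡ (suc n) c f =
  trans (cong (ℤ._+ (c ℤ.* f (suc n))) (sumTo-*ˡ n c f))
        (sym (ℤ.*-distribˡ-+ c (sumTo n f) (f (suc n))))

sumTo-head : ∀ n (f : Series) → sumTo (suc n) f ≡ f 0 ℤ.+ sumTo n (f ∘ suc)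
sumTo-head zero    f = refl
sumTo-head (suc n) f =
  trans (cong (ℤ._+ f (suc (suc n))) (sumTo-head n f)) (ℤ.+-assoc (f 0) _ _)

sumTo-reverse : ∀ n (f : Series) → sumTo n f ≡ sumTo n (λ k → f (n ∸ k))
sumTo-reverse zero    f = refl
sumTo-reverse (suc n) f = begin
  sumTo n f ℤ.+ f (suc n)                  ≡⟨ ℤ.+-comm (sumTo n f) _ ⟩
  f (suc n) ℤ.+ sumTo n f                  ≡⟨ cong (ℤ._+_ (f (suc n))) (sumTo-reverse n f) ⟩
  f (suc n) ℤ.+ sumTo n (λ k → f (n ∸ k))  ≡⟨ sumTo-head n (λ k → f (suc n ∸ k)) ⟨
  sumTo (suc n) (λ k → f (suc n ∸ k))      ∎
  where open ≡-Reasoning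

-- Power series and the Cauchy product

infixl 6 _⊕_
_⊕_ : Series → Series → Series
(a ⊕ b) n = a n ℤ.+ b n

infix 8 ⊖_
⊖_ : Series → Series
(⊖ a) n = ℤ.- a n

const : ℤ → Series
const z zero    = z
const z (suc _) = 0ℤ

X : Series
X zero          = 0ℤ
X (suc zero)    = 1ℤ
X (suc (suc _)) = 0ℤ

⊗-cong : ∀ n {a a′ b b′ : Series} →
         (∀ k → k ≤ n → a k ≡ a′ k) → (∀ k → k ≤ n → b k ≡ b′ k) →
         (a ⊗ b) n ≡ (a′ ⊗ b′) n
⊗-cong n a≗a′ b≗b′ =
  sumTo-cong n λ k k≤n → cong₂ ℤ._*_ (a≗a′ k k≤n) (b≗b′ (n ∸ k) (ℕ.m∸n≤m n k))

⊗-comm : ∀ a b n → (a ⊗ b) n ≡ (b ⊗ a) n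
⊗-comm a b n = begin
  sumTo n (λ k → a k ℤ.* b (n ∸ k))              ≡⟨ sumTo-reverse n _ ⟩
  sumTo n (λ k → a (n ∸ k) ℤ.* b (n ∸ (n ∸ k)))  ≡⟨ sumTo-cong n swap ⟩
  sumTo n (λ k → b k ℤ.* a (n ∸ k))              ∎
  where
  open ≡-Reasoning
  swap : ∀ k → k ≤ n → a (n ∸ k) ℤ.* b (n ∸ (n ∸ k)) ≡ b k ℤ.* a (n ∸ k)
  swap k k≤n = trans (cong (λ i → a (n ∸ k) ℤ.* b i) (ℕ.m∸[m∸n]≡n k≤n))
                     (ℤ.*-comm (a (n ∸ k)) (b k))

⊗-distribʳ : ∀ c a b n → ((a ⊕ b) ⊗ c) n ≡ ((a ⊗ c) ⊕ (b ⊗ c)) n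
⊗-distribʳ c a b n =
  trans (sumTo-cong n λ k _ → ℤ.*-distribʳ-+ (c (n ∸ k)) (a k) (b k)) (sumTo-+ n _ _)

⊗-distribˡ : ∀ c a b n → (c ⊗ (a ⊕ b)) n ≡ ((c ⊗ a) ⊕ (c ⊗ b)) n
⊗-distribˡ c a b n =
  trans (sumTo-cong n λ k _ → ℤ.*-distribˡ-+ (c k) (a (n ∸ k)) (b (n ∸ k))) (sumTo-+ n _ _)

⊗-scaleˡ : ∀ z a b n → ((λ k → z ℤ.* a k) ⊗ b) n ≡ z ℤ.* (a ⊗ b) n
⊗-scaleˡ z a b n =
  trans (sumTo-cong n λ k _ → ℤ.*-assoc z (a k) (b (n ∸ k))) (sumTo-*ˡ n z _)

⊗-suc : ∀ a b n → (a ⊗ b) (suc n) ≡ a 0 ℤ.* b (suc n) ℤ.+ ((a ∘ suc) ⊗ b) n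
⊗-suc a b n = sumTo-head n _

-- Induction on the degree, peeling off the constant term of the left factor by ⊗-suc.
⊗-assoc : ∀ a b c n → ((a ⊗ b) ⊗ c) n ≡ (a ⊗ (b ⊗ c)) n
⊗-assoc a b c zero    = ℤ.*-assoc (a 0) (b 0) (c 0)
⊗-assoc a b c (suc n) = begin
  ((a ⊗ b) ⊗ c) (suc n)
    ≡⟨ ⊗-suc (a ⊗ b) c n ⟩
  a 0 ℤ.* b 0 ℤ.* c (suc n) ℤ.+ (((a ⊗ b) ∘ suc) ⊗ c) n
    ≡⟨ cong (ℤ._+_ (a 0 ℤ.* b 0 ℤ.* c (suc n))) tail-part ⟩
  a 0 ℤ.* b 0 ℤ.* c (suc n) ℤ.+ (a 0 ℤ.* ((b ∘ suc) ⊗ c) n ℤ.+ ((a ∘ suc) ⊗ (b ⊗ c)) n)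
    ≡⟨ solve 5 (λ a₀ b₀ c₁ u v →
         a₀ :* b₀ :* c₁ :+ (a₀ :* u :+ v) := a₀ :* (b₀ :* c₁ :+ u) :+ v) refl
         (a 0) (b 0) (c (suc n)) (((b ∘ suc) ⊗ c) n) (((a ∘ suc) ⊗ (b ⊗ c)) n) ⟩
  a 0 ℤ.* (b 0 ℤ.* c (suc n) ℤ.+ ((b ∘ suc) ⊗ c) n) ℤ.+ ((a ∘ suc) ⊗ (b ⊗ c)) n
    ≡⟨ cong (λ u → a 0 ℤ.* u ℤ.+ ((a ∘ suc) ⊗ (b ⊗ c)) n) (⊗-suc b c n) ⟨
  a 0 ℤ.* (b ⊗ c) (suc n) ℤ.+ ((a ∘ suc) ⊗ (b ⊗ c)) n
    ≡⟨ ⊗-suc a (b ⊗ c) n ⟨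
  (a ⊗ (b ⊗ c)) (suc n)
    ∎
  where
  open ≡-Reasoning
  open +-*-Solver using (solve; _:=_; _:+_; _:*_)
  tail-part : (((a ⊗ b) ∘ suc) ⊗ c) n ≡
              a 0 ℤ.* ((b ∘ suc) ⊗ c) n ℤ.+ ((a ∘ suc) ⊗ (b ⊗ c)) n
  tail-part = begin
    (((a ⊗ b) ∘ suc) ⊗ c) n
      ≡⟨ ⊗-cong n {b = c} (λ k _ → ⊗-suc a b k) (λ _ _ → refl) ⟩
    (((λ k → a 0 ℤ.* b (suc k)) ⊕ ((a ∘ suc) ⊗ b)) ⊗ c) n
      ≡⟨ ⊗-distribʳ c (λ k → a 0 ℤ.* b (suc k)) ((a ∘ suc) ⊗ b) n ⟩
    ((λ k → a 0 ℤ.* b (suc k)) ⊗ c) n ℤ.+ (((a ∘ suc) ⊗ b) ⊗ c) n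
      ≡⟨ cong₂ ℤ._+_ (⊗-scaleˡ (a 0) (b ∘ suc) c n) (⊗-assoc (a ∘ suc) b c n) ⟩
    a 0 ℤ.* ((b ∘ suc) ⊗ c) n ℤ.+ ((a ∘ suc) ⊗ (b ⊗ c)) n
      ∎

const-⊗ : ∀ z a n → (const z ⊗ a) n ≡ z ℤ.* a n
const-⊗ z a zero    = refl
const-⊗ z a (suc n) = begin
  (const z ⊗ a) (suc n)                                ≡⟨ ⊗-suc (const z) a n ⟩
  z ℤ.* a (suc n) ℤ.+ sumTo n (λ k → 0ℤ ℤ.* a (n ∸ k)) ≡⟨ cong (ℤ._+_ (z ℤ.* a (suc n))) (sumTo-zero n λ k _ → refl) ⟩
  z ℤ.* a (suc n) ℤ.+ 0ℤ                               ≡⟨ ℤ.+-identityʳ _ ⟩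
  z ℤ.* a (suc n)                                      ∎
  where open ≡-Reasoning

one≗const : ∀ n → one n ≡ const 1ℤ n
one≗const zero    = refl
one≗const (suc n) = refl

⊗-identityˡ : ∀ a n → (one ⊗ a) n ≡ a n
⊗-identityˡ a n = trans (⊗-cong n {b = a} (λ k _ → one≗const k) (λ _ _ → refl))
                        (trans (const-⊗ 1ℤ a n) (ℤ.*-identityˡ (a n)))

X-⊗-suc : ∀ a n → (X ⊗ a) (suc n) ≡ a n
X-⊗-suc a n = begin
  (X ⊗ a) (suc n)                          ≡⟨ ⊗-suc X a n ⟩
  0ℤ ℤ.* a (suc n) ℤ.+ ((X ∘ suc) ⊗ a) n   ≡⟨ ℤ.+-identityˡ _ ⟩
  ((X ∘ suc) ⊗ a) n                        ≡⟨ ⊗-cong n {b = a} X∘suc≗one (λ _ _ → refl) ⟩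
  (one ⊗ a) n                              ≡⟨ ⊗-identityˡ a n ⟩
  a n                                      ∎
  where
  open ≡-Reasoning
  X∘suc≗one : ∀ k → k ≤ n → X (suc k) ≡ one k
  X∘suc≗one zero    _ = refl
  X∘suc≗one (suc k) _ = refl

pow-X-≡0 : ∀ {m n} → n < m → pow X m n ≡ 0ℤ
pow-X-≡0 {suc m} {zero}  _         = refl
pow-X-≡0 {suc m} {suc n} (s≤s n<m) = trans (X-⊗-suc (pow X m) n) (pow-X-≡0 n<m)

pow-constant : ∀ a → a 0 ≡ 1ℤ → ∀ n → pow a n 0 ≡ 1ℤ
pow-constant a a₀≡1 zero    = refl
pow-constant a a₀≡1 (suc n) = cong₂ ℤ._*_ a₀≡1 (pow-constant a a₀≡1 n)

-- Coefficient recursions for 1 - q^m and for inverse series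

-- The local functions behind oneMinusQ^ and inv are not exported by Defs, so they are named here by
-- unification; abstracting the successors turns the constraint on the metavariable into a pattern.
mutual
  oneMinusQ^-tail : ℕ → ℕ → ℕ → ℕ → ℤ
  oneMinusQ^-tail = _

  oneMinusQ^-suc : ∀ m n → oneMinusQ^ (suc m) (suc n) ≡ oneMinusQ^-tail (suc m) (suc n) m n
  oneMinusQ^-suc m n with suc m | suc n
  ... | _ | _ = refl

mutual
  inv-tail : Series → ℕ → ℕ → ℤ
  inv-tail = _

  inv-suc : ∀ a n → inv a (suc n) ≡ ℤ.- inv-tail a n 1
  inv-suc a n with 1
  ... | _ = refl

mutual
  inv-sum : Series → ℕ → ℕ → ℕ → ℤ
  inv-sum = _

  inv-tail-suc : ∀ a n k →
    inv-tail a (suc n) k ≡ a k ℤ.* inv a (suc n) ℤ.+ inv-sum a (suc n) n (suc k)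
  inv-tail-suc a n k with suc n | suc k
  ... | _ | _ = refl

-- `i` and `j` are the parameters of the `where` block, which its recursion carries along unchanged;
-- keeping them general lets the induction on `m` and `n` go through.
oneMinusQ^-tail≡ : ∀ i j m n → oneMinusQ^-tail i j m n ≡ ℤ.- pow X m n
oneMinusQ^-tail≡ i j zero    zero    = refl
oneMinusQ^-tail≡ i j zero    (suc n) = refl
oneMinusQ^-tail≡ i j (suc m) zero    = refl
oneMinusQ^-tail≡ i j (suc m) (suc n) =
  trans (oneMinusQ^-tail≡ i j m n) (cong ℤ.-_ (sym (X-⊗-suc (pow X m) n)))

oneMinusQ^≗ : ∀ m n → oneMinusQ^ (suc m) n ≡ (const 1ℤ ⊕ (⊖ pow X (suc m))) n
oneMinusQ^≗ m zero    = refl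
oneMinusQ^≗ m (suc n) = begin
  oneMinusQ^ (suc m) (suc n)              ≡⟨ oneMinusQ^-suc m n ⟩
  oneMinusQ^-tail (suc m) (suc n) m n     ≡⟨ oneMinusQ^-tail≡ (suc m) (suc n) m n ⟩
  ℤ.- pow X m n                           ≡⟨ cong ℤ.-_ (X-⊗-suc (pow X m) n) ⟨
  ℤ.- pow X (suc m) (suc n)               ≡⟨ ℤ.+-identityˡ _ ⟨
  0ℤ ℤ.+ ℤ.- pow X (suc m) (suc n)        ∎
  where open ≡-Reasoning

-- `inv-sum a m n k` is the local `go k` run on the list `inv a n`, ..., `inv a 0`, with `m` the
-- inert parameter of its `where` block. The descending order of the list is the one a convolution
-- calls for.
inv-sum≡ : ∀ a m n k → inv-sum a m n k ≡ sumTo n (λ j → a (k + j) ℤ.* inv a (n ∸ j))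
inv-sum≡ a m zero    k = trans (ℤ.+-identityʳ _) (cong (λ i → a i ℤ.* 1ℤ) (sym (ℕ.+-identityʳ k)))
inv-sum≡ a m (suc n) k = begin
  a k ℤ.* inv a (suc n) ℤ.+ inv-sum a m n (suc k)
    ≡⟨ cong₂ (λ i s → a i ℤ.* inv a (suc n) ℤ.+ s) (sym (ℕ.+-identityʳ k)) (inv-sum≡ a m n (suc k)) ⟩
  a (k + 0) ℤ.* inv a (suc n) ℤ.+ sumTo n (λ j → a (suc k + j) ℤ.* inv a (n ∸ j))
    ≡⟨ cong (ℤ._+_ (a (k + 0) ℤ.* inv a (suc n))) (sumTo-cong n λ j _ →
         cong (λ i → a i ℤ.* inv a (n ∸ j)) (sym (ℕ.+-suc k j))) ⟩
  a (k + 0) ℤ.* inv a (suc n) ℤ.+ sumTo n (λ j → a (k + suc j) ℤ.* inv a (n ∸ j))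
    ≡⟨ sumTo-head n (λ j → a (k + j) ℤ.* inv a (suc n ∸ j)) ⟨
  sumTo (suc n) (λ j → a (k + j) ℤ.* inv a (suc n ∸ j))
    ∎
  where open ≡-Reasoning

-- In positive degree the recursion for `inv` makes the leading term of the convolution equal to
-- minus the rest `t`.
⊗-inverseʳ : ∀ a → a 0 ≡ 1ℤ → ∀ n → (a ⊗ inv a) n ≡ one n
⊗-inverseʳ a a₀≡1 zero    = trans (ℤ.*-identityʳ (a 0)) a₀≡1
⊗-inverseʳ a a₀≡1 (suc n) = begin
  (a ⊗ inv a) (suc n)                   ≡⟨ ⊗-suc a (inv a) n ⟩
  a 0 ℤ.* inv a (suc n) ℤ.+ t           ≡⟨ cong (λ z → z ℤ.* inv a (suc n) ℤ.+ t) a₀≡1 ⟩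
  1ℤ ℤ.* inv a (suc n) ℤ.+ t            ≡⟨ cong (ℤ._+ t) (ℤ.*-identityˡ (inv a (suc n))) ⟩
  inv a (suc n) ℤ.+ t                   ≡⟨ cong (λ z → ℤ.- z ℤ.+ t) (inv-sum≡ a n n 1) ⟩
  ℤ.- t ℤ.+ t                           ≡⟨ ℤ.+-inverseˡ t ⟩
  0ℤ                                    ∎
  where
  open ≡-Reasoning
  t = ((a ∘ suc) ⊗ inv a) n

-- The ring of power series modulo q^{M+1}

infixl 7 _⊛_

-- Opacity keeps the conversion checker from unfolding nested products into sums.
opaque
  _⊛_ : Series → Series → Series
  _⊛_ = _⊗_

  ⊛≡⊗ : ∀ a b → a ⊛ b ≡ a ⊗ b
  ⊛≡⊗ a b = refl

const-⊛ : ∀ z a n → (const z ⊛ a) n ≡ z ℤ.* a n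
const-⊛ z a n = trans (cong (λ f → f n) (⊛≡⊗ (const z) a)) (const-⊗ z a n)

-- ℤ[[q]]/(q^{M+1})
module Truncated (M : ℕ) where

  infix 4 _≈_
  -- A record and not a bare function type, so that unification can recover `a` and `b` from
  -- `a ≈ b`.
  record _≈_ (a b : Series) : Set where
    constructor ≈-intro
    field
      ≈-at : ∀ n → n ≤ M → a n ≡ b n
  open _≈_ public

  ≗⇒≈ : ∀ {a b : Series} → (∀ n → a n ≡ b n) → a ≈ b
  ≗⇒≈ a≗b = ≈-intro λ n _ → a≗b n

  opaque
    unfolding _⊛_

    isCommutativeRing : IsCommutativeRing _≈_ _⊕_ _⊛_ ⊖_ (λ _ → 0ℤ) one
    isCommutativeRing = record
      { isRing = record
        { +-isAbelianGroup = record
          { isGroup = record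
            { isMonoid = record
              { isSemigroup = record
                { isMagma = record
                  { isEquivalence = record
                    { refl  = ≗⇒≈ λ _ → refl
                    ; sym   = λ p → ≈-intro λ n n≤M → sym (≈-at p n n≤M)
                    ; trans = λ p q → ≈-intro λ n n≤M → trans (≈-at p n n≤M) (≈-at q n n≤M)
                    }
                  ; ∙-cong = λ p q → ≈-intro λ n n≤M → cong₂ ℤ._+_ (≈-at p n n≤M) (≈-at q n n≤M)
                  }
                ; assoc = λ a b c → ≗⇒≈ λ n → ℤ.+-assoc (a n) (b n) (c n)
                }
              ; identity = (λ a → ≗⇒≈ λ n → ℤ.+-identityˡ (a n)) , (λ a → ≗⇒≈ λ n → ℤ.+-identityʳ (a n))
              }
            ; inverse = (λ a → ≗⇒≈ λ n → ℤ.+-inverseˡ (a n)) , (λ a → ≗⇒≈ λ n → ℤ.+-inverseʳ (a n))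
            ; ⁻¹-cong = λ p → ≈-intro λ n n≤M → cong ℤ.-_ (≈-at p n n≤M)
            }
          ; comm = λ a b → ≗⇒≈ λ n → ℤ.+-comm (a n) (b n)
          }
        ; *-cong = λ p q → ≈-intro λ n n≤M → ⊗-cong n
            (λ k k≤n → ≈-at p k (ℕ.≤-trans k≤n n≤M)) (λ k k≤n → ≈-at q k (ℕ.≤-trans k≤n n≤M))
        ; *-assoc = λ a b c → ≗⇒≈ (⊗-assoc a b c)
        ; *-identity = (λ a → ≗⇒≈ (⊗-identityˡ a))
                     , (λ a → ≗⇒≈ λ n → trans (⊗-comm a one n) (⊗-identityˡ a n))
        ; distrib = (λ c a b → ≗⇒≈ (⊗-distribˡ c a b)) , (λ c a b → ≗⇒≈ (⊗-distribʳ c a b))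
        }
      ; *-comm = λ a b → ≗⇒≈ (⊗-comm a b)
      }

  seriesRing : CommutativeRing _ _
  seriesRing = record { isCommutativeRing = isCommutativeRing }

  -- Gives the ring solver integer coefficients.
  constHom : CommutativeRing.rawRing ℤ.+-*-commutativeRing
             -Raw-AlmostCommutative⟶ fromCommutativeRing seriesRing
  constHom = record
    { ⟦_⟧    = const
    ; +-homo = λ x y → ≗⇒≈ λ { zero → refl ; (suc n) → refl }
    ; *-homo = λ x y → ≗⇒≈ λ
        { zero    → sym (const-⊛ x (const y) 0)
        ; (suc n) → sym (trans (const-⊛ x (const y) (suc n)) (ℤ.*-zeroʳ x)) }
    ; -‿homo = λ x → ≗⇒≈ λ { zero → refl ; (suc n) → refl }
    ; 0-homo = ≗⇒≈ λ { zero → refl ; (suc n) → refl }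
    ; 1-homo = ≗⇒≈ λ n → sym (one≗const n)
    }

-- Shanks' identity in a commutative ring

module ThetaSeries
  {a ℓ} (R : CommutativeRing a ℓ)
  (ℤ→R : CommutativeRing.rawRing ℤ.+-*-commutativeRing
         -Raw-AlmostCommutative⟶ fromCommutativeRing R)
  (q : CommutativeRing.Carrier R)
  where

  open CommutativeRing R
    renaming (_+_ to _⊞_; _*_ to _⊠_; -_ to ⊟_; refl to ≈-refl; sym to ≈-sym; trans to ≈-trans)
    hiding (zero)
  open _-Raw-AlmostCommutative⟶_ ℤ→R using (1-homo) renaming (⟦_⟧ to κ)
  open Algebra.Properties.Semiring.Exp semiring using (_^_; ^-homo-*; ^-congˡ)
  open Algebra.Solver.Ring (CommutativeRing.rawRing ℤ.+-*-commutativeRing)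
    (fromCommutativeRing R) ℤ→R
    (λ x y → Maybe.map (reflexive ∘ cong κ) (dec⇒maybe (x ℤ.≟ y)))
    using (Polynomial; var; con; ⟦_⟧; solve; _:=_; _:+_; _:*_; _:-_; :-_; _:^_)
  open Relation.Binary.Reasoning.Setoid setoid

  -- Constants are written with `κ` because the solver's `con` evaluates to it; `1-homo` mediates
  -- with the `1#` that `q ^ 0` produces.
  sgn : ℕ → Carrier
  sgn zero    = κ 1ℤ
  sgn (suc n) = ⊟ sgn n

  -- (q;q)_n, (-q;q)_n and (q²;q²)_n
  qPoch qPoch⁻ qPoch² : ℕ → Carrier
  qPoch zero     = κ 1ℤ
  qPoch (suc n)  = (κ 1ℤ - q ^ suc n) ⊠ qPoch n
  qPoch⁻ zero    = κ 1ℤ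
  qPoch⁻ (suc n) = (κ 1ℤ ⊞ q ^ suc n) ⊠ qPoch⁻ n
  qPoch² zero    = κ 1ℤ
  qPoch² (suc n) = (κ 1ℤ - q ^ (2 * suc n)) ⊠ qPoch² n

  -- `θ n` is the partial sum of φ(-q) up to the term in q^{n²}.
  squares θ : ℕ → Carrier
  squares zero    = κ 0ℤ
  squares (suc n) = squares n ⊞ sgn (suc n) ⊠ q ^ (suc n * suc n)
  θ n = κ 1ℤ ⊞ κ (+ 2) ⊠ squares n

  Σ≤ : ℕ → (ℕ → Carrier) → Carrier
  Σ≤ zero    f = f 0
  Σ≤ (suc n) f = Σ≤ n f ⊞ f (suc n)

  Σ≤-cong : ∀ m {f g} → (∀ s → s ≤ m → f s ≈ g s) → Σ≤ m f ≈ Σ≤ m g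
  Σ≤-cong zero    f≈g = f≈g 0 z≤n
  Σ≤-cong (suc m) f≈g =
    +-cong (Σ≤-cong m λ s → f≈g s ∘ ℕ.m≤n⇒m≤1+n) (f≈g (suc m) ℕ.≤-refl)

  Σ≤-linear : ∀ m z f g → Σ≤ m (λ s → f s ⊞ z ⊠ g s) ≈ Σ≤ m f ⊞ z ⊠ Σ≤ m g
  Σ≤-linear zero    z f g = ≈-refl
  Σ≤-linear (suc m) z f g = begin
    Σ≤ m (λ s → f s ⊞ z ⊠ g s) ⊞ (f (suc m) ⊞ z ⊠ g (suc m))  ≈⟨ +-congʳ (Σ≤-linear m z f g) ⟩
    (Σ≤ m f ⊞ z ⊠ Σ≤ m g) ⊞ (f (suc m) ⊞ z ⊠ g (suc m))
      ≈⟨ solve 5 (λ a b c d z → (a :+ z :* b) :+ (c :+ z :* d) := (a :+ c) :+ z :* (b :+ d))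
           ≈-refl (Σ≤ m f) (Σ≤ m g) (f (suc m)) (g (suc m)) z ⟩
    (Σ≤ m f ⊞ f (suc m)) ⊞ z ⊠ (Σ≤ m g ⊞ g (suc m))           ∎

  -- This is (-1;q)_s. Its factor of index 0 is 1 + q^0 = 2, so `c-suc` holds at s = 0 as well.
  c : ℕ → Carrier
  c zero    = κ 1ℤ
  c (suc s) = κ (+ 2) ⊠ qPoch⁻ s

  c-suc : ∀ s → c (suc s) ≈ c s ⊠ (κ 1ℤ ⊞ q ^ s)
  c-suc zero    = begin
    κ (+ 2) ⊠ κ 1ℤ            ≈⟨ solve 0 (con (+ 2) :* con 1ℤ := con 1ℤ :* (con 1ℤ :+ con 1ℤ)) ≈-refl ⟩
    κ 1ℤ ⊠ (κ 1ℤ ⊞ κ 1ℤ)      ≈⟨ *-congˡ (+-congˡ 1-homo) ⟩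
    κ 1ℤ ⊠ (κ 1ℤ ⊞ q ^ 0)     ∎
  c-suc (suc s) =
    solve 2 (λ x b → con (+ 2) :* ((con 1ℤ :+ x) :* b) := con (+ 2) :* b :* (con 1ℤ :+ x))
      ≈-refl (q ^ suc s) (qPoch⁻ s)

  -- (q^{s+1};q)_d
  shifted : ℕ → ℕ → Carrier
  shifted s zero    = κ 1ℤ
  shifted s (suc d) = (κ 1ℤ - q ^ suc (s + d)) ⊠ shifted s d

  -- The definition splits off the factor with the largest exponent; `E-sucʳ` needs the one with the
  -- smallest.
  shifted-suc : ∀ s d → shifted s (suc d) ≈ shifted (suc s) d ⊠ (κ 1ℤ - q ^ suc s)
  shifted-suc s zero    = begin
    (κ 1ℤ - q ^ suc (s + 0)) ⊠ κ 1ℤ  ≡⟨ cong (λ i → (κ 1ℤ - q ^ suc i) ⊠ κ 1ℤ) (ℕ.+-identityʳ s) ⟩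
    (κ 1ℤ - q ^ suc s) ⊠ κ 1ℤ        ≈⟨ *-comm _ _ ⟩
    κ 1ℤ ⊠ (κ 1ℤ - q ^ suc s)        ∎
  shifted-suc s (suc d) = begin
    (κ 1ℤ - q ^ suc (s + suc d)) ⊠ shifted s (suc d)
      ≈⟨ *-congˡ (shifted-suc s d) ⟩
    (κ 1ℤ - q ^ suc (s + suc d)) ⊠ (shifted (suc s) d ⊠ (κ 1ℤ - q ^ suc s))
      ≡⟨ cong (λ i → (κ 1ℤ - q ^ suc i) ⊠ (shifted (suc s) d ⊠ (κ 1ℤ - q ^ suc s))) (ℕ.+-suc s d) ⟩
    (κ 1ℤ - q ^ suc (suc s + d)) ⊠ (shifted (suc s) d ⊠ (κ 1ℤ - q ^ suc s))
      ≈⟨ *-assoc _ _ _ ⟨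
    (κ 1ℤ - q ^ suc (suc s + d)) ⊠ shifted (suc s) d ⊠ (κ 1ℤ - q ^ suc s)
      ∎

  shifted-zero : ∀ n → shifted 0 n ≈ qPoch n
  shifted-zero zero    = ≈-refl
  shifted-zero (suc n) = *-congˡ (shifted-zero n)

  -- Only meant for s ≤ n.
  E : ℕ → ℕ → Carrier
  E n s = c s ⊠ shifted s (n ∸ s)

  E-diagonal : ∀ n → E n n ≈ c n
  E-diagonal n = begin
    c n ⊠ shifted n (n ∸ n)  ≡⟨ cong (λ d → c n ⊠ shifted n d) (ℕ.n∸n≡0 n) ⟩
    c n ⊠ κ 1ℤ               ≈⟨ *-congˡ 1-homo ⟩
    c n ⊠ 1#                 ≈⟨ *-identityʳ _ ⟩
    c n                      ∎

  E-sucˡ : ∀ {n s} → s ≤ n → E (suc n) s ≈ (κ 1ℤ - q ^ suc n) ⊠ E n s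
  E-sucˡ {n} {s} s≤n = begin
    c s ⊠ shifted s (suc n ∸ s)
      ≡⟨ cong (λ d → c s ⊠ shifted s d) (ℕ.+-∸-assoc 1 s≤n) ⟩
    c s ⊠ ((κ 1ℤ - q ^ suc (s + (n ∸ s))) ⊠ shifted s (n ∸ s))
      ≡⟨ cong (λ i → c s ⊠ ((κ 1ℤ - q ^ suc i) ⊠ shifted s (n ∸ s))) (ℕ.m+[n∸m]≡n s≤n) ⟩
    c s ⊠ ((κ 1ℤ - q ^ suc n) ⊠ shifted s (n ∸ s))
      ≈⟨ solve 3 (λ a b c → a :* (b :* c) := b :* (a :* c)) ≈-refl _ _ _ ⟩
    (κ 1ℤ - q ^ suc n) ⊠ (c s ⊠ shifted s (n ∸ s))
      ∎

  -- Passing from s to s+1 removes the bottom factor 1 - q^{s+1} of `shifted` and adds the factor 1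
  -- + q^s to `c`. The removed factor is kept on the left to avoid a division.
  E-sucʳ : ∀ {n s} → s < n → E n (suc s) ⊠ (κ 1ℤ - q ^ suc s) ≈ E n s ⊠ (κ 1ℤ ⊞ q ^ s)
  E-sucʳ {n} {s} s<n = begin
    c (suc s) ⊠ shifted (suc s) (n ∸ suc s) ⊠ (κ 1ℤ - q ^ suc s)
      ≈⟨ *-assoc _ _ _ ⟩
    c (suc s) ⊠ (shifted (suc s) (n ∸ suc s) ⊠ (κ 1ℤ - q ^ suc s))
      ≈⟨ *-cong (c-suc s) (≈-sym (shifted-suc s (n ∸ suc s))) ⟩
    c s ⊠ (κ 1ℤ ⊞ q ^ s) ⊠ shifted s (suc (n ∸ suc s))
      ≡⟨ cong (λ d → c s ⊠ (κ 1ℤ ⊞ q ^ s) ⊠ shifted s d) (ℕ.+-∸-assoc 1 s<n) ⟨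
    c s ⊠ (κ 1ℤ ⊞ q ^ s) ⊠ shifted s (n ∸ s)
      ≈⟨ solve 3 (λ a b c → a :* b :* c := a :* c :* b) ≈-refl _ _ _ ⟩
    c s ⊠ shifted s (n ∸ s) ⊠ (κ 1ℤ ⊞ q ^ s)
      ∎

  shanksTerm : ℕ → ℕ → Carrier
  shanksTerm n s = sgn s ⊠ (E n s ⊠ q ^ (s * suc n))

  q^-suc* : ∀ m n → q ^ (m * suc n) ≈ q ^ m ⊠ q ^ (m * n)
  q^-suc* m n = begin
    q ^ (m * suc n)    ≡⟨ cong (q ^_) (ℕ.*-suc m n) ⟩
    q ^ (m + m * n)    ≈⟨ ^-homo-* q m (m * n) ⟩
    q ^ m ⊠ q ^ (m * n) ∎

  -- Going from n to n+1 multiplies (-q;q)_n by 1 + q^{n+1}, so the induction in `shanks` compares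
  -- each new summand with 1 + q^{n+1} times the old one.
  increment : ℕ → ℕ → Carrier
  increment n s = shanksTerm (suc n) s ⊞ (⊟ (κ 1ℤ ⊞ q ^ suc n)) ⊠ shanksTerm n s

  -- With x = q^s and y = q^{n+1}, this is (1 - y)x - (1 + y) = -(1 - x + y(1 + x)) times a common
  -- factor.
  increment≈ : ∀ {n s} → s ≤ n → increment n s ≈
    sgn (suc s) ⊠ (E n s ⊠ (κ 1ℤ - q ^ s ⊞ q ^ suc n ⊠ (κ 1ℤ ⊞ q ^ s)) ⊠ q ^ (s * suc n))
  increment≈ {n} {s} s≤n = begin
    sgn s ⊠ (E (suc n) s ⊠ q ^ (s * suc (suc n))) ⊞ (⊟ (κ 1ℤ ⊞ q ^ suc n)) ⊠ shanksTerm n s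
      ≈⟨ +-congʳ (*-congˡ (*-cong (E-sucˡ s≤n) (q^-suc* s (suc n)))) ⟩
    sgn s ⊠ ((κ 1ℤ - q ^ suc n) ⊠ E n s ⊠ (q ^ s ⊠ q ^ (s * suc n)))
      ⊞ (⊟ (κ 1ℤ ⊞ q ^ suc n)) ⊠ (sgn s ⊠ (E n s ⊠ q ^ (s * suc n)))
      ≈⟨ solve 5 (λ g y e x z →
           g :* ((con 1ℤ :- y) :* e :* (x :* z)) :+ (:- (con 1ℤ :+ y)) :* (g :* (e :* z)) :=
           (:- g) :* (e :* (con 1ℤ :- x :+ y :* (con 1ℤ :+ x)) :* z)) ≈-refl
           (sgn s) (q ^ suc n) (E n s) (q ^ s) (q ^ (s * suc n)) ⟩
    (⊟ sgn s) ⊠ (E n s ⊠ (κ 1ℤ - q ^ s ⊞ q ^ suc n ⊠ (κ 1ℤ ⊞ q ^ s)) ⊠ q ^ (s * suc n))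
      ∎

  -- By `increment≈` each increment has a part with 1 - q^s and a part with q^{n+1}(1 + q^s). By
  -- `E-sucʳ` the first part at s+1 cancels the second part at s, so only the last second part
  -- survives.
  telescope : ∀ {n} m → m ≤ n → Σ≤ m (increment n) ≈
    sgn (suc m) ⊠ (E n m ⊠ (κ 1ℤ ⊞ q ^ m) ⊠ q ^ (suc m * suc n))
  telescope {n} zero _ = begin
    increment n 0
      ≈⟨ increment≈ {n} z≤n ⟩
    (⊟ sgn 0) ⊠ (E n 0 ⊠ (κ 1ℤ - 1# ⊞ q ^ suc n ⊠ (κ 1ℤ ⊞ 1#)) ⊠ 1#)
      ≈⟨ *-congˡ (*-cong (*-congˡ (+-cong (+-congˡ (-‿cong 1-homo)) (*-congˡ (+-congˡ 1-homo)))) 1-homo) ⟨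
    (⊟ sgn 0) ⊠ (E n 0 ⊠ (κ 1ℤ - κ 1ℤ ⊞ q ^ suc n ⊠ (κ 1ℤ ⊞ κ 1ℤ)) ⊠ κ 1ℤ)
      -- At s = 0 the first part is absent, as 1 - q^0 = 0.
      ≈⟨ solve 3 (λ g e y →
           g :* (e :* (con 1ℤ :- con 1ℤ :+ y :* (con 1ℤ :+ con 1ℤ)) :* con 1ℤ) :=
           g :* (e :* (con 1ℤ :+ con 1ℤ) :* y)) ≈-refl (⊟ sgn 0) (E n 0) (q ^ suc n) ⟩
    (⊟ sgn 0) ⊠ (E n 0 ⊠ (κ 1ℤ ⊞ κ 1ℤ) ⊠ q ^ suc n)
      ≈⟨ *-congˡ (*-congʳ (*-congˡ (+-congˡ 1-homo))) ⟩
    (⊟ sgn 0) ⊠ (E n 0 ⊠ (κ 1ℤ ⊞ q ^ 0) ⊠ q ^ suc n)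
      ≡⟨ cong (λ i → (⊟ sgn 0) ⊠ (E n 0 ⊠ (κ 1ℤ ⊞ q ^ 0) ⊠ q ^ i)) (ℕ.*-identityˡ (suc n)) ⟨
    (⊟ sgn 0) ⊠ (E n 0 ⊠ (κ 1ℤ ⊞ q ^ 0) ⊠ q ^ (1 * suc n))
      ∎
  telescope {n} (suc m) m<n = begin
    Σ≤ m (increment n) ⊞ increment n (suc m)
      ≈⟨ +-cong (telescope m (ℕ.<⇒≤ m<n)) (increment≈ m<n) ⟩
    g ⊠ (E n m ⊠ (κ 1ℤ ⊞ q ^ m) ⊠ z) ⊞ (⊟ g) ⊠ (e ⊠ (κ 1ℤ - x ⊞ y ⊠ (κ 1ℤ ⊞ x)) ⊠ z)
      ≈⟨ +-congʳ (*-congˡ (*-congʳ (E-sucʳ m<n))) ⟨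
    g ⊠ (e ⊠ (κ 1ℤ - x) ⊠ z) ⊞ (⊟ g) ⊠ (e ⊠ (κ 1ℤ - x ⊞ y ⊠ (κ 1ℤ ⊞ x)) ⊠ z)
      ≈⟨ solve 5 (λ g e x y z →
           g :* (e :* (con 1ℤ :- x) :* z)
             :+ (:- g) :* (e :* (con 1ℤ :- x :+ y :* (con 1ℤ :+ x)) :* z) :=
           (:- g) :* (e :* (con 1ℤ :+ x) :* (y :* z))) ≈-refl g e x y z ⟩
    (⊟ g) ⊠ (e ⊠ (κ 1ℤ ⊞ x) ⊠ (y ⊠ z))
      ≈⟨ *-congˡ (*-congˡ (^-homo-* q (suc n) (suc m * suc n))) ⟨
    (⊟ g) ⊠ (e ⊠ (κ 1ℤ ⊞ x) ⊠ q ^ (suc (suc m) * suc n))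
      ∎
    where
    g = sgn (suc m)
    e = E n (suc m)
    x = q ^ suc m
    y = q ^ suc n
    z = q ^ (suc m * suc n)

  shanks : ∀ n → qPoch⁻ n ⊠ θ n ≈ Σ≤ n (shanksTerm n)
  shanks zero = begin
    κ 1ℤ ⊠ (κ 1ℤ ⊞ κ (+ 2) ⊠ κ 0ℤ)
      ≈⟨ solve 0 (con 1ℤ :* (con 1ℤ :+ con (+ 2) :* con 0ℤ) :=
                  con 1ℤ :* (con 1ℤ :* con 1ℤ :* con 1ℤ)) ≈-refl ⟩
    κ 1ℤ ⊠ (κ 1ℤ ⊠ κ 1ℤ ⊠ κ 1ℤ)
      ≈⟨ *-congˡ (*-congˡ 1-homo) ⟩
    κ 1ℤ ⊠ (κ 1ℤ ⊠ κ 1ℤ ⊠ 1#)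
      ∎
  shanks (suc n) = begin
    (κ 1ℤ ⊞ y) ⊠ b ⊠ (κ 1ℤ ⊞ κ (+ 2) ⊠ (squares n ⊞ g ⊠ w))
      -- The new square contributes 2(1 + y)bgw. Its part without y is the telescoped sum of the
      -- increments; its part with y is the new summand s = n+1, since wy = q^{(n+1)(n+2)}.
      ≈⟨ solve 5 (λ y b t g w →
           (con 1ℤ :+ y) :* b :* (con 1ℤ :+ con (+ 2) :* (t :+ g :* w)) :=
           (g :* (con (+ 2) :* b :* w) :+ (con 1ℤ :+ y) :* (b :* (con 1ℤ :+ con (+ 2) :* t)))
             :+ g :* (con (+ 2) :* b :* (w :* y))) ≈-refl y b (squares n) g w ⟩
    (g ⊠ (c (suc n) ⊠ w) ⊞ (κ 1ℤ ⊞ y) ⊠ (b ⊠ θ n)) ⊞ g ⊠ (c (suc n) ⊠ (w ⊠ y))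
      ≈⟨ +-cong (+-cong first-part (*-congˡ (shanks n))) last-part ⟩
    (Σ≤ n (increment n) ⊞ (κ 1ℤ ⊞ y) ⊠ Σ≤ n (shanksTerm n)) ⊞ shanksTerm (suc n) (suc n)
      ≈⟨ +-congʳ (+-congʳ (Σ≤-linear n (⊟ (κ 1ℤ ⊞ y)) (shanksTerm (suc n)) (shanksTerm n))) ⟩
    (Σ≤ n (shanksTerm (suc n)) ⊞ (⊟ (κ 1ℤ ⊞ y)) ⊠ Σ≤ n (shanksTerm n)
      ⊞ (κ 1ℤ ⊞ y) ⊠ Σ≤ n (shanksTerm n)) ⊞ shanksTerm (suc n) (suc n)
      ≈⟨ +-congʳ (solve 3 (λ a z b → a :+ (:- z) :* b :+ z :* b := a) ≈-refl _ _ _) ⟩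
    Σ≤ n (shanksTerm (suc n)) ⊞ shanksTerm (suc n) (suc n)
      ∎
    where
    y = q ^ suc n
    b = qPoch⁻ n
    g = sgn (suc n)
    w = q ^ (suc n * suc n)

    first-part : g ⊠ (c (suc n) ⊠ w) ≈ Σ≤ n (increment n)
    first-part = begin
      g ⊠ (c (suc n) ⊠ w)                    ≈⟨ *-congˡ (*-congʳ (c-suc n)) ⟩
      g ⊠ (c n ⊠ (κ 1ℤ ⊞ q ^ n) ⊠ w)         ≈⟨ *-congˡ (*-congʳ (*-congʳ (E-diagonal n))) ⟨
      g ⊠ (E n n ⊠ (κ 1ℤ ⊞ q ^ n) ⊠ w)       ≈⟨ telescope n ℕ.≤-refl ⟨
      Σ≤ n (increment n)                     ∎

    last-part : g ⊠ (c (suc n) ⊠ (w ⊠ y)) ≈ shanksTerm (suc n) (suc n)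
    last-part = *-congˡ (*-cong (≈-sym (E-diagonal (suc n)))
      (≈-trans (*-comm w y) (≈-sym (q^-suc* (suc n) (suc n)))))

  -- The summand s = 0 is (q;q)_n, and each later one carries q^{s(n+1)}. The bound `m` is separate
  -- from `n` so that it can be the induction variable.
  shanks-remainder : ∀ m n → ∃ λ r → Σ≤ m (shanksTerm n) ≈ qPoch n ⊞ q ^ suc n ⊠ r
  shanks-remainder zero n = κ 0ℤ , (begin
    κ 1ℤ ⊠ (κ 1ℤ ⊠ shifted 0 n ⊠ 1#)      ≈⟨ *-congˡ (*-cong (*-congˡ (shifted-zero n)) (≈-sym 1-homo)) ⟩
    κ 1ℤ ⊠ (κ 1ℤ ⊠ qPoch n ⊠ κ 1ℤ)
      ≈⟨ solve 2 (λ u y → con 1ℤ :* (con 1ℤ :* u :* con 1ℤ) := u :+ y :* con 0ℤ)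
           ≈-refl (qPoch n) (q ^ suc n) ⟩
    qPoch n ⊞ q ^ suc n ⊠ κ 0ℤ            ∎)
  shanks-remainder (suc m) n with shanks-remainder m n
  ... | r , eq = r ⊞ g ⊠ (e ⊠ z) , (begin
    Σ≤ m (shanksTerm n) ⊞ g ⊠ (e ⊠ q ^ (suc m * suc n))
      ≈⟨ +-cong eq (*-congˡ (*-congˡ (^-homo-* q (suc n) (m * suc n)))) ⟩
    (qPoch n ⊞ y ⊠ r) ⊞ g ⊠ (e ⊠ (y ⊠ z))
      ≈⟨ solve 6 (λ u y r g e z →
           (u :+ y :* r) :+ g :* (e :* (y :* z)) := u :+ y :* (r :+ g :* (e :* z)))
           ≈-refl (qPoch n) y r g e z ⟩
    qPoch n ⊞ y ⊠ (r ⊞ g ⊠ (e ⊠ z))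
      ∎)
    where
    g = sgn (suc m)
    e = E n (suc m)
    y = q ^ suc n
    z = q ^ (m * suc n)

  -- Gauss's identity

  qPoch⁻*qPoch : ∀ n → qPoch⁻ n ⊠ qPoch n ≈ qPoch² n
  qPoch⁻*qPoch zero    = solve 0 (con 1ℤ :* con 1ℤ := con 1ℤ) ≈-refl
  qPoch⁻*qPoch (suc n) = begin
    (κ 1ℤ ⊞ x) ⊠ qPoch⁻ n ⊠ ((κ 1ℤ - x) ⊠ qPoch n)
      ≈⟨ solve 3 (λ x b u → (con 1ℤ :+ x) :* b :* ((con 1ℤ :- x) :* u) :=
                            (con 1ℤ :- x :* x) :* (b :* u)) ≈-refl x (qPoch⁻ n) (qPoch n) ⟩
    (κ 1ℤ - x ⊠ x) ⊠ (qPoch⁻ n ⊠ qPoch n)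
      ≈⟨ *-cong (+-congˡ (-‿cong (≈-sym x²))) (qPoch⁻*qPoch n) ⟩
    (κ 1ℤ - q ^ (2 * suc n)) ⊠ qPoch² n
      ∎
    where
    x = q ^ suc n
    x² : q ^ (2 * suc n) ≈ x ⊠ x
    x² = begin
      q ^ (2 * suc n)       ≡⟨ cong (λ i → q ^ (suc n + i)) (ℕ.*-identityˡ (suc n)) ⟩
      q ^ (suc n + suc n)   ≈⟨ ^-homo-* q (suc n) (suc n) ⟩
      x ⊠ x                 ∎

  -- Shanks' identity multiplied by (q;q)_n, where q^{n+1} = 0 kills the remainder. It is φ(-q) =
  -- (q;q)²/(q²;q²) cleared of its denominator.
  gauss : ∀ n → q ^ suc n ≈ κ 0ℤ → qPoch² n ⊠ θ n ≈ qPoch n ⊠ qPoch n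
  gauss n q^n≈0 with shanks-remainder n n
  ... | r , eq = begin
    qPoch² n ⊠ θ n                   ≈⟨ *-congʳ (qPoch⁻*qPoch n) ⟨
    qPoch⁻ n ⊠ qPoch n ⊠ θ n         ≈⟨ solve 3 (λ a b c → a :* b :* c := b :* (a :* c)) ≈-refl _ _ _ ⟩
    qPoch n ⊠ (qPoch⁻ n ⊠ θ n)       ≈⟨ *-congˡ (≈-trans (shanks n) eq) ⟩
    qPoch n ⊠ (qPoch n ⊞ q ^ suc n ⊠ r) ≈⟨ *-congˡ (+-congˡ (*-congʳ q^n≈0)) ⟩
    qPoch n ⊠ (qPoch n ⊞ κ 0ℤ ⊠ r)   ≈⟨ solve 2 (λ u r → u :* (u :+ con 0ℤ :* r) := u :* u) ≈-refl (qPoch n) r ⟩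
    qPoch n ⊠ qPoch n                ∎

  -- The inverse seventh power modulo 128

  -- Here p stands for v⁷/u¹⁴ and t for u²/v. Inserting 1 = (v v′)⁷ supplies the factor v⁷ that
  -- turns t⁷ into u¹⁴.
  cancel-θ : ∀ {p u v v′ t} → p ⊠ u ^ 14 ≈ v ^ 7 → v ⊠ v′ ≈ κ 1ℤ → v ⊠ t ≈ u ⊠ u → p ⊠ t ^ 7 ≈ κ 1ℤ
  cancel-θ {p} {u} {v} {v′} {t} pu¹⁴≈v⁷ vv′≈1 vt≈uu = begin
    p ⊠ t ^ 7
      ≈⟨ solve 2 (λ p t → p :* t :^ 7 := p :* t :^ 7 :* con 1ℤ :^ 7) ≈-refl p t ⟩
    p ⊠ t ^ 7 ⊠ κ 1ℤ ^ 7
      ≈⟨ *-congˡ (^-congˡ 7 vv′≈1) ⟨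
    p ⊠ t ^ 7 ⊠ (v ⊠ v′) ^ 7
      ≈⟨ solve 4 (λ p t v v′ → p :* t :^ 7 :* (v :* v′) :^ 7 := p :* (v :* t) :^ 7 :* v′ :^ 7)
           ≈-refl p t v v′ ⟩
    p ⊠ (v ⊠ t) ^ 7 ⊠ v′ ^ 7
      ≈⟨ *-congʳ (*-congˡ (^-congˡ 7 vt≈uu)) ⟩
    p ⊠ (u ⊠ u) ^ 7 ⊠ v′ ^ 7
      ≈⟨ *-congʳ (*-congˡ (solve 1 (λ u → (u :* u) :^ 7 := u :^ 14) ≈-refl u)) ⟩
    p ⊠ u ^ 14 ⊠ v′ ^ 7
      ≈⟨ *-congʳ pu¹⁴≈v⁷ ⟩
    v ^ 7 ⊠ v′ ^ 7
      ≈⟨ solve 2 (λ v v′ → v :^ 7 :* v′ :^ 7 := (v :* v′) :^ 7) ≈-refl v v′ ⟩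
    (v ⊠ v′) ^ 7
      ≈⟨ ^-congˡ 7 vv′≈1 ⟩
    κ 1ℤ ^ 7
      ≈⟨ solve 0 (con 1ℤ :^ 7 := con 1ℤ) ≈-refl ⟩
    κ 1ℤ
      ∎

  -- Multiply the polynomial identity 1 = (1 + 2s)⁷ Q(s) + 128 N(s) by p.
  inverse-seventh-power : ∀ p s → p ⊠ (κ 1ℤ ⊞ κ (+ 2) ⊠ s) ^ 7 ≈ κ 1ℤ →
    ∃ λ r → p ≈ κ 1ℤ - κ (+ 14) ⊠ s - κ (+ 16) ⊠ s ^ 2 - κ (+ 32) ⊠ s ^ 3
                ⊞ κ (+ 32) ⊠ s ^ 4 ⊞ κ (+ 64) ⊠ s ^ 5 ⊞ κ (+ 128) ⊠ r
  inverse-seventh-power p s inverse = r , (begin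
    p
      ≈⟨ solve 2 (λ p s →
           p := (p :* (con 1ℤ :+ con (+ 2) :* s) :^ 7) :* Q s :+ con (+ 128) :* (p :* N s))
           ≈-refl p s ⟩
    (p ⊠ (κ 1ℤ ⊞ κ (+ 2) ⊠ s) ^ 7) ⊠ _ ⊞ κ (+ 128) ⊠ r
      ≈⟨ +-congʳ (*-congʳ inverse) ⟩
    κ 1ℤ ⊠ _ ⊞ κ (+ 128) ⊠ r
      ≈⟨ +-congʳ (solve 1 (λ s → con 1ℤ :* Q s := Q s) ≈-refl s) ⟩
    _ ⊞ κ (+ 128) ⊠ r
      ∎)
    where
    Q N : ∀ {n} → Polynomial n → Polynomial n
    -- The coefficients are 2^k binom(-7,k) modulo 128: 112 ≡ -16, -672 ≡ -32, 3360 ≡ 32 and -14784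
    -- ≡ 64. For k = 6 the value is 128 · 462, and from k = 7 on 2^k is divisible by 128.
    Q s = con 1ℤ :- con (+ 14) :* s :- con (+ 16) :* s :^ 2 :- con (+ 32) :* s :^ 3
          :+ con (+ 32) :* s :^ 4 :+ con (+ 64) :* s :^ 5
    -- N(s) = (1 - (1 + 2s)⁷ Q(s)) / 128
    N s = s :^ 2 :* (con (+ 1) :+ s :* (con (+ 9) :+ s :* (con (+ 40) :+ s :* (con (+ 108) :+
          s :* (con (+ 182) :+ s :* (con (+ 160) :+ s :* (con (ℤ.- + 42) :+ s :* (con (ℤ.- + 320) :+
          s :* (con (ℤ.- + 416) :+ s :* (con (ℤ.- + 256) :+ s :* con (ℤ.- + 64)))))))))))
    r = p ⊠ ⟦ N (var zero) ⟧ (s ∷ [])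

  -- `u′` inverts `u ^ 14` and not `u`, because `pbar` is defined with the inverse of a power.
  quotient-expansion : ∀ n {u v u′ v′} → q ^ suc n ≈ κ 0ℤ → u ≈ qPoch n → v ≈ qPoch² n →
    u ^ 14 ⊠ u′ ≈ 1# → v ⊠ v′ ≈ 1# →
    ∃ λ r → v ^ 7 ⊠ u′ ≈ κ 1ℤ - κ (+ 14) ⊠ squares n - κ (+ 16) ⊠ squares n ^ 2
      - κ (+ 32) ⊠ squares n ^ 3 ⊞ κ (+ 32) ⊠ squares n ^ 4 ⊞ κ (+ 64) ⊠ squares n ^ 5 ⊞ κ (+ 128) ⊠ r
  quotient-expansion n {u} {v} {u′} {v′} q^1+n≈0 u≈ v≈ uu′≈1 vv′≈1 =
    inverse-seventh-power (v ^ 7 ⊠ u′) (squares n)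
      (cancel-θ numerator (≈-trans vv′≈1 (≈-sym 1-homo)) vθ≈uu)
    where
    numerator : v ^ 7 ⊠ u′ ⊠ u ^ 14 ≈ v ^ 7
    numerator = begin
      v ^ 7 ⊠ u′ ⊠ u ^ 14    ≈⟨ *-assoc _ _ _ ⟩
      v ^ 7 ⊠ (u′ ⊠ u ^ 14)  ≈⟨ *-congˡ (≈-trans (*-comm _ _) uu′≈1) ⟩
      v ^ 7 ⊠ 1#             ≈⟨ *-identityʳ _ ⟩
      v ^ 7                  ∎

    vθ≈uu : v ⊠ θ n ≈ u ⊠ u
    vθ≈uu = begin
      v ⊠ θ n                ≈⟨ *-congʳ v≈ ⟩
      qPoch² n ⊠ θ n         ≈⟨ gauss n q^1+n≈0 ⟩
      qPoch n ⊠ qPoch n      ≈⟨ *-cong u≈ u≈ ⟨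
      u ⊠ u                  ∎

  -- In all four expansions exponents 0 and coefficients 1 are written out, so that `vanish` fits
  -- every monomial.
  binomial-square : ∀ o e → (o ⊞ e) ^ 2 ≈
    κ (+ 1) ⊠ (o ^ 2 ⊠ e ^ 0) ⊞ κ (+ 2) ⊠ (o ^ 1 ⊠ e ^ 1)
    ⊞ κ (+ 1) ⊠ (o ^ 0 ⊠ e ^ 2)
  binomial-square =
    solve 2 (λ o e → (o :+ e) :^ 2 :=
      con (+ 1) :* (o :^ 2 :* e :^ 0) :+ con (+ 2) :* (o :^ 1 :* e :^ 1)
      :+ con (+ 1) :* (o :^ 0 :* e :^ 2)) ≈-refl

  binomial-cube : ∀ o e → (o ⊞ e) ^ 3 ≈
    κ (+ 1) ⊠ (o ^ 3 ⊠ e ^ 0) ⊞ κ (+ 3) ⊠ (o ^ 2 ⊠ e ^ 1)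
    ⊞ κ (+ 3) ⊠ (o ^ 1 ⊠ e ^ 2) ⊞ κ (+ 1) ⊠ (o ^ 0 ⊠ e ^ 3)
  binomial-cube =
    solve 2 (λ o e → (o :+ e) :^ 3 :=
      con (+ 1) :* (o :^ 3 :* e :^ 0) :+ con (+ 3) :* (o :^ 2 :* e :^ 1)
      :+ con (+ 3) :* (o :^ 1 :* e :^ 2) :+ con (+ 1) :* (o :^ 0 :* e :^ 3)) ≈-refl

  binomial-fourth : ∀ o e → (o ⊞ e) ^ 4 ≈
    κ (+ 1) ⊠ (o ^ 4 ⊠ e ^ 0) ⊞ κ (+ 4) ⊠ (o ^ 3 ⊠ e ^ 1)
    ⊞ κ (+ 6) ⊠ (o ^ 2 ⊠ e ^ 2) ⊞ κ (+ 4) ⊠ (o ^ 1 ⊠ e ^ 3)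
    ⊞ κ (+ 1) ⊠ (o ^ 0 ⊠ e ^ 4)
  binomial-fourth =
    solve 2 (λ o e → (o :+ e) :^ 4 :=
      con (+ 1) :* (o :^ 4 :* e :^ 0) :+ con (+ 4) :* (o :^ 3 :* e :^ 1)
      :+ con (+ 6) :* (o :^ 2 :* e :^ 2) :+ con (+ 4) :* (o :^ 1 :* e :^ 3)
      :+ con (+ 1) :* (o :^ 0 :* e :^ 4)) ≈-refl

  binomial-fifth : ∀ o e → (o ⊞ e) ^ 5 ≈
    κ (+ 1) ⊠ (o ^ 5 ⊠ e ^ 0) ⊞ κ (+ 5) ⊠ (o ^ 4 ⊠ e ^ 1)
    ⊞ κ (+ 10) ⊠ (o ^ 3 ⊠ e ^ 2) ⊞ κ (+ 10) ⊠ (o ^ 2 ⊠ e ^ 3)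
    ⊞ κ (+ 5) ⊠ (o ^ 1 ⊠ e ^ 4) ⊞ κ (+ 1) ⊠ (o ^ 0 ⊠ e ^ 5)
  binomial-fifth =
    solve 2 (λ o e → (o :+ e) :^ 5 :=
      con (+ 1) :* (o :^ 5 :* e :^ 0) :+ con (+ 5) :* (o :^ 4 :* e :^ 1)
      :+ con (+ 10) :* (o :^ 3 :* e :^ 2) :+ con (+ 10) :* (o :^ 2 :* e :^ 3)
      :+ con (+ 5) :* (o :^ 1 :* e :^ 4) :+ con (+ 1) :* (o :^ 0 :* e :^ 5)) ≈-refl

-- Truncating the infinite products

-- The added factor 1 - q^{(k+1)(N+1)} is 1 modulo q^{N+1}; its exponent is `suc m` by computation.
finProd-suc : ∀ k {n N} → n ≤ N → finProd (suc k) (suc N) n ≡ finProd (suc k) N n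
finProd-suc k {n} {N} n≤N = trans
  (⊗-cong n {b = finProd (suc k) N} (λ j j≤n → factor j (ℕ.≤-trans j≤n n≤N)) (λ _ _ → refl))
  (⊗-identityˡ (finProd (suc k) N) n)
  where
  m = N + k * suc N
  factor : ∀ j → j ≤ N → oneMinusQ^ (suc m) j ≡ one j
  factor j j≤N = begin
    oneMinusQ^ (suc m) j                  ≡⟨ oneMinusQ^≗ m j ⟩
    const 1ℤ j ℤ.+ ℤ.- pow X (suc m) j    ≡⟨ cong₂ (λ x y → x ℤ.+ ℤ.- y) (sym (one≗const j))
                                                (pow-X-≡0 (s≤s (ℕ.m≤n⇒m≤n+o (k * suc N) j≤N))) ⟩
    one j ℤ.+ 0ℤ                          ≡⟨ ℤ.+-identityʳ (one j) ⟩
    one j                                 ∎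
    where open ≡-Reasoning

-- `qPochSuc` uses a different finite product in each degree; here one product serves all degrees up
-- to N.
qPochSuc≡finProd : ∀ k {n N} → n ≤ N → qPochSuc k n ≡ finProd (suc k) N n
qPochSuc≡finProd k {n} {N} n≤N =
  trans (stable (N ∸ n)) (cong (λ N → finProd (suc k) N n) (ℕ.m∸n+n≡m n≤N))
  where
  stable : ∀ d → qPochSuc k n ≡ finProd (suc k) (d + n) n
  stable zero    = refl
  stable (suc d) = trans (stable d) (sym (finProd-suc k (ℕ.m≤n+m n d)))

-- Series supported in a residue class

-- `r` may exceed `m`, so that the residues of a product simply add.
record Supported (m : ℕ) .{{_ : NonZero m}} (r : ℕ) (a : Series) : Set where
  constructor supported
  field
    vanishes : ∀ n → n % m ≢ r % m → a n ≡ 0ℤ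
open Supported

module _ (m : ℕ) .{{_ : NonZero m}} where

  const-supported : ∀ z → Supported m 0 (const z)
  const-supported z = supported λ
    { zero    0≢0 → ⊥-elim (0≢0 refl)
    ; (suc n) _   → refl
    }

  one-supported : Supported m 0 one
  one-supported = supported λ n n≢0 → trans (one≗const n) (vanishes (const-supported 1ℤ) n n≢0)

  X-supported : Supported m 1 X
  X-supported = supported λ
    { zero          _   → refl
    ; (suc zero)    1≢1 → ⊥-elim (1≢1 refl)
    ; (suc (suc n)) _   → refl
    }

  ⊕-supported : ∀ {r a b} → Supported m r a → Supported m r b → Supported m r (a ⊕ b)
  ⊕-supported a-supp b-supp =
    supported λ n n≢r → cong₂ ℤ._+_ (vanishes a-supp n n≢r) (vanishes b-supp n n≢r)

  ⊖-supported : ∀ {r a} → Supported m r a → Supported m r (⊖ a)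
  ⊖-supported a-supp = supported λ n n≢r → cong ℤ.-_ (vanishes a-supp n n≢r)

  ⊗-supported : ∀ {r s a b} → Supported m r a → Supported m s b → Supported m (r + s) (a ⊗ b)
  ⊗-supported {r} {s} {a} {b} a-supp b-supp = supported λ n n≢r+s → sumTo-zero n (term n n≢r+s)
    where
    term : ∀ n → n % m ≢ (r + s) % m → ∀ k → k ≤ n → a k ℤ.* b (n ∸ k) ≡ 0ℤ
    term n n≢r+s k k≤n with k % m ℕ.≟ r % m | (n ∸ k) % m ℕ.≟ s % m
    ... | no k≢r  | _       = cong (ℤ._* b (n ∸ k)) (vanishes a-supp k k≢r)
    ... | yes _   | no l≢s  =
      trans (cong (a k ℤ.*_) (vanishes b-supp (n ∸ k) l≢s)) (ℤ.*-zeroʳ (a k))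
    ... | yes k≡r | yes l≡s = ⊥-elim (n≢r+s (begin
      n % m                      ≡⟨ cong (_% m) (ℕ.m+[n∸m]≡n k≤n) ⟨
      (k + (n ∸ k)) % m          ≡⟨ %-distribˡ-+ k (n ∸ k) m ⟩
      (k % m + (n ∸ k) % m) % m  ≡⟨ cong₂ (λ i j → (i + j) % m) k≡r l≡s ⟩
      (r % m + s % m) % m        ≡⟨ %-distribˡ-+ r s m ⟨
      (r + s) % m                ∎))
      where open ≡-Reasoning

  ⊛-supported : ∀ {r s a b} → Supported m r a → Supported m s b → Supported m (r + s) (a ⊛ b)
  ⊛-supported {r} {s} {a} {b} a-supp b-supp =
    subst (Supported m (r + s)) (sym (⊛≡⊗ a b)) (⊗-supported a-supp b-supp)

  pow-X-supported : ∀ k → Supported m k (pow X k)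
  pow-X-supported zero    = one-supported
  pow-X-supported (suc k) = ⊗-supported X-supported (pow-X-supported k)

%8⇒%4 : ∀ n r → n % 8 ≡ r % 8 → n % 4 ≡ r % 4
%8⇒%4 n r n≡r = begin
  n % 4      ≡⟨ m∣n⇒o%n%m≡o%m 4 8 n 4∣8 ⟨
  n % 8 % 4  ≡⟨ cong (_% 4) n≡r ⟩
  r % 8 % 4  ≡⟨ m∣n⇒o%n%m≡o%m 4 8 r 4∣8 ⟩
  r % 4      ∎
  where
  open ≡-Reasoning
  4∣8 = ℕ∣.divides 2 refl

supported-8⇒4 : ∀ {r a} → Supported 8 r a → Supported 4 r a
supported-8⇒4 {r} a-supp = supported λ n n≢r → vanishes a-supp n (n≢r ∘ %8⇒%4 n r)

-- The residues have period 4 in k, because (k + 4)² = k² + 8(k + 2).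
square-residue : ∀ k → k * k % 8 ≡ 1 ⊎ k * k % 4 ≡ 0
square-residue 0 = inj₂ refl
square-residue 1 = inj₁ refl
square-residue 2 = inj₂ refl
square-residue 3 = inj₁ refl
square-residue (suc (suc (suc (suc k)))) with square-residue k
... | inj₁ k²≡1 = inj₁ (trans (cong (_% 8) (expand k)) (trans ([m+kn]%n≡m%n (k * k) (k + 2) 8) k²≡1))
  where
  expand : ∀ k → (4 + k) * (4 + k) ≡ k * k + (k + 2) * 8
  expand = solve 1 (λ k → (con 4 :+ k) :* (con 4 :+ k) := k :* k :+ (k :+ con 2) :* con 8) refl
    where open ℕ-Solver
... | inj₂ k²≡0 = inj₂ (trans (cong (_% 4) (expand k)) (trans ([m+kn]%n≡m%n (k * k) (2 * (k + 2)) 4) k²≡0))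
  where
  expand : ∀ k → (4 + k) * (4 + k) ≡ k * k + 2 * (k + 2) * 4
  expand = solve 1 (λ k → (con 4 :+ k) :* (con 4 :+ k) := k :* k :+ con 2 :* (k :+ con 2) :* con 4) refl
    where open ℕ-Solver

-- Divisibility of the expansion

-- (1 + 2s)⁻⁷ modulo 128, with sᵢ in the role of a coefficient of sⁱ.
expansion : (u s₁ s₂ s₃ s₄ s₅ r : ℤ) → ℤ
expansion u s₁ s₂ s₃ s₄ s₅ r =
  u ℤ.- + 14 ℤ.* s₁ ℤ.- + 16 ℤ.* s₂ ℤ.- + 32 ℤ.* s₃ ℤ.+ + 32 ℤ.* s₄ ℤ.+ + 64 ℤ.* s₅ ℤ.+ + 128 ℤ.* r

module _ where
  open +-*-Solver

  private
    expansionₚ : ∀ {n} (u s₁ s₂ s₃ s₄ s₅ r : Polynomial n) → Polynomial n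
    expansionₚ u s₁ s₂ s₃ s₄ s₅ r =
      u :- con (+ 14) :* s₁ :- con (+ 16) :* s₂ :- con (+ 32) :* s₃
        :+ con (+ 32) :* s₄ :+ con (+ 64) :* s₅ :+ con (+ 128) :* r

  2∣expansion : ∀ {u} s₁ s₂ s₃ s₄ s₅ r → u ≡ 0ℤ → + 2 ∣ expansion u s₁ s₂ s₃ s₄ s₅ r
  2∣expansion s₁ s₂ s₃ s₄ s₅ r refl = ∣⇒∣ᵤ (divides
    (ℤ.- + 7 ℤ.* s₁ ℤ.- + 8 ℤ.* s₂ ℤ.- + 16 ℤ.* s₃ ℤ.+ + 16 ℤ.* s₄ ℤ.+ + 32 ℤ.* s₅ ℤ.+ + 64 ℤ.* r)
    (solve 6 (λ s₁ s₂ s₃ s₄ s₅ r → expansionₚ (con 0ℤ) s₁ s₂ s₃ s₄ s₅ r :=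
      (con (ℤ.- + 7) :* s₁ :- con (+ 8) :* s₂ :- con (+ 16) :* s₃
        :+ con (+ 16) :* s₄ :+ con (+ 32) :* s₅ :+ con (+ 64) :* r) :* con (+ 2))
      refl s₁ s₂ s₃ s₄ s₅ r))

  16∣expansion : ∀ {u s₁} s₂ s₃ s₄ s₅ r → u ≡ 0ℤ → s₁ ≡ 0ℤ → + 16 ∣ expansion u s₁ s₂ s₃ s₄ s₅ r
  16∣expansion s₂ s₃ s₄ s₅ r refl refl = ∣⇒∣ᵤ (divides
    (ℤ.- s₂ ℤ.- + 2 ℤ.* s₃ ℤ.+ + 2 ℤ.* s₄ ℤ.+ + 4 ℤ.* s₅ ℤ.+ + 8 ℤ.* r)
    (solve 5 (λ s₂ s₃ s₄ s₅ r → expansionₚ (con 0ℤ) (con 0ℤ) s₂ s₃ s₄ s₅ r :=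
      (:- s₂ :- con (+ 2) :* s₃ :+ con (+ 2) :* s₄ :+ con (+ 4) :* s₅ :+ con (+ 8) :* r)
        :* con (+ 16))
      refl s₂ s₃ s₄ s₅ r))

  32∣expansion : ∀ {u s₁ s₂} s₃ s₄ s₅ r → u ≡ 0ℤ → s₁ ≡ 0ℤ → s₂ ≡ 0ℤ →
    + 32 ∣ expansion u s₁ s₂ s₃ s₄ s₅ r
  32∣expansion s₃ s₄ s₅ r refl refl refl = ∣⇒∣ᵤ (divides (ℤ.- s₃ ℤ.+ s₄ ℤ.+ + 2 ℤ.* s₅ ℤ.+ + 4 ℤ.* r)
    (solve 4 (λ s₃ s₄ s₅ r → expansionₚ (con 0ℤ) (con 0ℤ) (con 0ℤ) s₃ s₄ s₅ r :=
      (:- s₃ :+ s₄ :+ con (+ 2) :* s₅ :+ con (+ 4) :* r) :* con (+ 32))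
      refl s₃ s₄ s₅ r))

  -- The factors 4 and 2 complete the coefficients 32 and 64 to 128.
  128∣expansion : ∀ {u s₁ s₂ s₃ s₄ s₅} r → u ≡ 0ℤ → s₁ ≡ 0ℤ → s₂ ≡ 0ℤ → s₃ ≡ 0ℤ →
    (∃ λ x → s₄ ≡ + 4 ℤ.* x) → (∃ λ x → s₅ ≡ + 2 ℤ.* x) →
    + 128 ∣ expansion u s₁ s₂ s₃ s₄ s₅ r
  128∣expansion r refl refl refl refl (x , refl) (y , refl) = ∣⇒∣ᵤ (divides (x ℤ.+ y ℤ.+ r)
    (solve 3 (λ x y r →
      expansionₚ (con 0ℤ) (con 0ℤ) (con 0ℤ) (con 0ℤ) (con (+ 4) :* x) (con (+ 2) :* y) r :=
      (x :+ y :+ r) :* con (+ 128))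
      refl x y r))

-- The coefficient of q^M, computed modulo q^{M+1}

module Coefficient (M : ℕ) where

  open Truncated M
  open CommutativeRing seriesRing
    using (semiring; *-cong; reflexive) renaming (trans to ≈-trans; _-_ to _⊝_)
  open Algebra.Properties.Semiring.Exp semiring using (_^_; ^-congˡ)
  open ThetaSeries seriesRing constHom X

  ⊗≈⊛ : ∀ a b → a ⊗ b ≈ a ⊛ b
  ⊗≈⊛ a b = reflexive (sym (⊛≡⊗ a b))

  pow≡^ : ∀ a n → pow a n ≡ a ^ n
  pow≡^ a zero    = refl
  pow≡^ a (suc n) = trans (cong (a ⊗_) (pow≡^ a n)) (sym (⊛≡⊗ a (a ^ n)))

  oneMinusQ^≈ : ∀ m → oneMinusQ^ (suc m) ≈ const 1ℤ ⊝ X ^ suc m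
  oneMinusQ^≈ m = ≗⇒≈ λ n →
    trans (oneMinusQ^≗ m n) (cong (λ a → (const 1ℤ ⊝ a) n) (pow≡^ X (suc m)))

  one≈const : one ≈ const 1ℤ
  one≈const = ≗⇒≈ one≗const

  finProd₁≈qPoch : ∀ N → finProd 1 N ≈ qPoch N
  finProd₁≈qPoch zero    = one≈const
  finProd₁≈qPoch (suc N) = ≈-trans (⊗≈⊛ _ _) (*-cong
    (≈-trans (oneMinusQ^≈ (N + 0)) (reflexive (cong (λ i → const 1ℤ ⊝ X ^ suc i) (ℕ.+-identityʳ N))))
    (finProd₁≈qPoch N))

  finProd₂≈qPoch² : ∀ N → finProd 2 N ≈ qPoch² N
  finProd₂≈qPoch² zero    = one≈const
  finProd₂≈qPoch² (suc N) =
    ≈-trans (⊗≈⊛ _ _) (*-cong (oneMinusQ^≈ (N + 1 * suc N)) (finProd₂≈qPoch² N))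

  qPochSuc₀≈qPoch : qPochSuc 0 ≈ qPoch M
  qPochSuc₀≈qPoch =
    ≈-trans (≈-intro λ n n≤M → qPochSuc≡finProd 0 n≤M) (finProd₁≈qPoch M)

  qPochSuc₁≈qPoch² : qPochSuc 1 ≈ qPoch² M
  qPochSuc₁≈qPoch² =
    ≈-trans (≈-intro λ n n≤M → qPochSuc≡finProd 1 n≤M) (finProd₂≈qPoch² M)

  X^1+M≈0 : X ^ suc M ≈ const 0ℤ
  X^1+M≈0 = ≈-intro λ n n≤M → begin
    (X ^ suc M) n    ≡⟨ cong (λ a → a n) (pow≡^ X (suc M)) ⟨
    pow X (suc M) n  ≡⟨ pow-X-≡0 (s≤s n≤M) ⟩
    0ℤ               ≡⟨ const-0 n ⟨
    const 0ℤ n       ∎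
    where
    open ≡-Reasoning
    const-0 : ∀ n → const 0ℤ n ≡ 0ℤ
    const-0 zero    = refl
    const-0 (suc n) = refl

  s : Series
  s = squares M

  -- The equation `a ≡ b` pairs the inverse of a `pow` with the corresponding `^`.
  ⊛-inverseʳ : ∀ {a b} → a 0 ≡ 1ℤ → a ≡ b → b ⊛ inv a ≈ one
  ⊛-inverseʳ {a} a₀≡1 refl = ≈-trans (reflexive (⊛≡⊗ a (inv a))) (≗⇒≈ (⊗-inverseʳ a a₀≡1))

  u¹⁴ : Series
  u¹⁴ = pow (qPochSuc 0) 14

  pbar≡ : pbar 7 ≡ (qPochSuc 1 ^ 7) ⊛ inv u¹⁴
  pbar≡ = trans (sym (⊛≡⊗ (pow (qPochSuc 1) 7) (inv u¹⁴))) (cong (_⊛ inv u¹⁴) (pow≡^ (qPochSuc 1) 7))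

  pbar-expansion : ∃ λ r → pbar 7 ≈
    const 1ℤ ⊝ const (+ 14) ⊛ s ⊝ const (+ 16) ⊛ (s ^ 2) ⊝ const (+ 32) ⊛ (s ^ 3)
      ⊕ const (+ 32) ⊛ (s ^ 4) ⊕ const (+ 64) ⊛ (s ^ 5) ⊕ const (+ 128) ⊛ r
  pbar-expansion = map₂ (≈-trans (reflexive pbar≡))
    (quotient-expansion M {qPochSuc 0} {qPochSuc 1} {inv u¹⁴} {inv (qPochSuc 1)}
      X^1+M≈0 qPochSuc₀≈qPoch qPochSuc₁≈qPoch²
      (⊛-inverseʳ {u¹⁴} {qPochSuc 0 ^ 14} (pow-constant (qPochSuc 0) refl 14) (pow≡^ (qPochSuc 0) 14))
      (⊛-inverseʳ {qPochSuc 1} refl refl))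

  pbar-coefficient : ∃ λ r → pbar 7 M ≡
    expansion (const 1ℤ M) (s M) ((s ^ 2) M) ((s ^ 3) M) ((s ^ 4) M) ((s ^ 5) M) r
  pbar-coefficient = map (λ r → r M) (λ {r} eq →
    trans (≈-at eq M ℕ.≤-refl) (combination s (s ^ 2) (s ^ 3) (s ^ 4) (s ^ 5) r)) pbar-expansion
    where
    combination : ∀ a b c d e f →
      (const 1ℤ ⊝ const (+ 14) ⊛ a ⊝ const (+ 16) ⊛ b ⊝ const (+ 32) ⊛ c
        ⊕ const (+ 32) ⊛ d ⊕ const (+ 64) ⊛ e ⊕ const (+ 128) ⊛ f) M ≡
      expansion (const 1ℤ M) (a M) (b M) (c M) (d M) (e M) (f M)
    combination a b c d e f
      rewrite const-⊛ (+ 14) a M | const-⊛ (+ 16) b M | const-⊛ (+ 32) c M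
            | const-⊛ (+ 32) d M | const-⊛ (+ 64) e M | const-⊛ (+ 128) f M = refl

  -- Supports of the powers of s

  sgn-supported : ∀ m .{{_ : NonZero m}} n → Supported m 0 (sgn n)
  sgn-supported m zero    = const-supported m 1ℤ
  sgn-supported m (suc n) = ⊖-supported m (sgn-supported m n)

  summand-supported : ∀ m .{{_ : NonZero m}} n {r} → n * n % m ≡ r % m →
                      Supported m r (sgn n ⊛ (X ^ (n * n)))
  summand-supported m n n²≡r = supported λ k k≢r → vanishes
    (⊛-supported m (sgn-supported m n)
      (subst (Supported m (n * n)) (pow≡^ X (n * n)) (pow-X-supported m (n * n))))
    k (λ k≡n² → k≢r (trans k≡n² n²≡r))

  -- `square-residue` decides which part receives each new square. The finer modulus 8 for `o` is
  -- what the cube needs when M ≡ 7 mod 8.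
  squares-split : ∀ n → ∃₂ λ o e → Supported 8 1 o × Supported 4 0 e × squares n ≈ o ⊕ e
  squares-split zero =
    const 0ℤ , const 0ℤ , supported (λ { zero _ → refl ; (suc _) _ → refl }) , const-supported 4 0ℤ ,
    ≗⇒≈ λ { zero → refl ; (suc _) → refl }
  squares-split (suc n) with squares-split n | square-residue (suc n)
  ... | o , e , o-supp , e-supp , eq | inj₁ odd =
    o ⊕ t , e , ⊕-supported 8 o-supp (summand-supported 8 (suc n) odd) , e-supp ,
    ≈-intro λ k k≤M → trans (cong (ℤ._+ t k) (≈-at eq k k≤M))
      (solve 3 (λ o e t → o :+ e :+ t := o :+ t :+ e) refl (o k) (e k) (t k))
    where
    open +-*-Solver
    t = sgn (suc n) ⊛ (X ^ (suc n * suc n))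
  ... | o , e , o-supp , e-supp , eq | inj₂ even =
    o , e ⊕ t , o-supp , ⊕-supported 4 e-supp (summand-supported 4 (suc n) even) ,
    ≈-intro λ k k≤M → trans (cong (ℤ._+ t k) (≈-at eq k k≤M)) (ℤ.+-assoc (o k) (e k) (t k))
    where
    t = sgn (suc n) ⊛ (X ^ (suc n * suc n))

  ^-supported : ∀ m .{{_ : NonZero m}} {r a} → Supported m r a → ∀ k → Supported m (k * r) (a ^ k)
  ^-supported m a-supp zero    = one-supported m
  ^-supported m a-supp (suc k) = ⊛-supported m a-supp (^-supported m a-supp k)

  -- The consequences of the split s = o + e, in a form that no longer mentions `o` and `e`.
  record PowerCoefficients : Set where
    field
      s¹≡0   : ∀ {r} → M % 4 ≡ r → r ≢ 0 → r ≢ 1 → s M ≡ 0ℤ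
      s²≡0   : M % 4 ≡ 3 → (s ^ 2) M ≡ 0ℤ
      s³≡0   : M % 8 ≡ 7 → (s ^ 3) M ≡ 0ℤ
      s⁴≡4*x : M % 4 ≡ 3 → ∃ λ x → (s ^ 4) M ≡ + 4 ℤ.* x
      s⁵≡2*x : M % 4 ≡ 3 → ∃ λ x → (s ^ 5) M ≡ + 2 ℤ.* x

  powerCoefficients : PowerCoefficients
  powerCoefficients with squares-split M
  ... | o , e , o-supp₈ , e-supp , s≈o+e = record
    { s¹≡0 = λ M≡r r≢0 r≢1 → trans (≈-at s≈o+e M ℕ.≤-refl)
        (cong₂ ℤ._+_ (vanishes o-supp M (r≢1 ∘ trans (sym M≡r)))
                     (vanishes e-supp M (r≢0 ∘ trans (sym M≡r))))
    ; s²≡0 = λ M≡3 → trans (expand 2 binomial-square)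
        (cong₂ ℤ._+_ (cong₂ ℤ._+_ (vanish 1 2 0 M≡3 λ ()) (vanish 2 1 1 M≡3 λ ()))
          (vanish 1 0 2 M≡3 λ ()))
    ; s³≡0 = λ M≡7 → let M≡3 = %8⇒%4 M 7 M≡7 in trans (expand 3 binomial-cube)
        (cong₂ ℤ._+_ (cong₂ ℤ._+_ (cong₂ ℤ._+_ (o³-vanishes M≡7) (vanish 3 2 1 M≡3 λ ()))
          (vanish 3 1 2 M≡3 λ ())) (vanish 1 0 3 M≡3 λ ()))
    -- Only 4o³e survives.
    ; s⁴≡4*x = λ M≡3 → (o ^ 3 ⊛ e ^ 1) M , trans (expand 4 binomial-fourth)
        (trans (cong₂ ℤ._+_ (cong₂ ℤ._+_ (cong₂ ℤ._+_ (cong₂ ℤ._+_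
          (vanish 1 4 0 M≡3 λ ()) (const-⊛ (+ 4) (o ^ 3 ⊛ e ^ 1) M)) (vanish 6 2 2 M≡3 λ ()))
          (vanish 4 1 3 M≡3 λ ())) (vanish 1 0 4 M≡3 λ ()))
          (solve 1 (λ x → con 0ℤ :+ con (+ 4) :* x :+ con 0ℤ :+ con 0ℤ :+ con 0ℤ :=
                          con (+ 4) :* x) refl ((o ^ 3 ⊛ e ^ 1) M)))
    -- Only 10o³e² survives, and 10 = 2 · 5.
    ; s⁵≡2*x = λ M≡3 → + 5 ℤ.* (o ^ 3 ⊛ e ^ 2) M , trans (expand 5 binomial-fifth)
        (trans (cong₂ ℤ._+_ (cong₂ ℤ._+_ (cong₂ ℤ._+_ (cong₂ ℤ._+_ (cong₂ ℤ._+_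
          (vanish 1 5 0 M≡3 λ ()) (vanish 5 4 1 M≡3 λ ())) (const-⊛ (+ 10) (o ^ 3 ⊛ e ^ 2) M))
          (vanish 10 2 3 M≡3 λ ())) (vanish 5 1 4 M≡3 λ ())) (vanish 1 0 5 M≡3 λ ()))
          (solve 1 (λ x → con 0ℤ :+ con 0ℤ :+ con (+ 10) :* x :+ con 0ℤ :+ con 0ℤ :+ con 0ℤ :=
                          con (+ 2) :* (con (+ 5) :* x)) refl ((o ^ 3 ⊛ e ^ 2) M)))
    }
    where
    open +-*-Solver

    o-supp : Supported 4 1 o
    o-supp = supported-8⇒4 o-supp₈

    expand : ∀ k {f : Series → Series → Series} → (∀ o e → (o ⊕ e) ^ k ≈ f o e) → (s ^ k) M ≡ f o e M
    expand k binomial = ≈-at (≈-trans (^-congˡ k s≈o+e) (binomial o e)) M ℕ.≤-refl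

    monomial-supported : ∀ z i j → Supported 4 (0 + (i * 1 + j * 0)) (const (+ z) ⊛ (o ^ i ⊛ e ^ j))
    monomial-supported z i j =
      ⊛-supported 4 (const-supported 4 (+ z))
        (⊛-supported 4 (^-supported 4 o-supp i) (^-supported 4 e-supp j))

    -- The monomial lives in degrees ≡ i mod 4. For concrete exponents the condition on the residue
    -- is settled by evaluation.
    vanish : ∀ z i j → M % 4 ≡ 3 → 3 ≢ (i * 1 + j * 0) % 4 → (const (+ z) ⊛ (o ^ i ⊛ e ^ j)) M ≡ 0ℤ
    vanish z i j M≡3 3≢r = vanishes (monomial-supported z i j) M λ M≡r → 3≢r (trans (sym M≡3) M≡r)

    -- Modulo 4 the degrees of o³ would agree with M; modulo 8 they are 3 and M is 7.
    o³-vanishes : M % 8 ≡ 7 → (const 1ℤ ⊛ (o ^ 3 ⊛ e ^ 0)) M ≡ 0ℤ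
    o³-vanishes M≡7 = vanishes (⊛-supported 8 (const-supported 8 1ℤ)
      (⊛-supported 8 (^-supported 8 o-supp₈ 3) (one-supported 8)))
      M λ M≡3 → contradiction (trans (sym M≡7) M≡3) λ ()

  open PowerCoefficients powerCoefficients

  constant-vanishes : ∀ r → M % 8 ≡ r → r ≢ 0 → const 1ℤ M ≡ 0ℤ
  constant-vanishes r M≡r r≢0 = vanishes (const-supported 8 1ℤ) M λ M≡0 → r≢0 (trans (sym M≡r) M≡0)

  -- Only the constant term of the expansion is odd, and a nonzero residue excludes degree 0.
  2∣pbar : ∀ r → M % 8 ≡ r → r ≢ 0 → + 2 ∣ pbar 7 M
  2∣pbar i M≡i i≢0 = let r , eq = pbar-coefficient in subst (+ 2 ∣_) (sym eq)
    (2∣expansion (s M) ((s ^ 2) M) ((s ^ 3) M) ((s ^ 4) M) ((s ^ 5) M) r (constant-vanishes i M≡i i≢0))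

  16∣pbar : M % 8 ≡ 2 → + 16 ∣ pbar 7 M
  16∣pbar M≡2 = let r , eq = pbar-coefficient in subst (+ 16 ∣_) (sym eq)
    (16∣expansion ((s ^ 2) M) ((s ^ 3) M) ((s ^ 4) M) ((s ^ 5) M) r (constant-vanishes 2 M≡2 λ ())
      (s¹≡0 (%8⇒%4 M 2 M≡2) (λ ()) (λ ())))

  32∣pbar : M % 8 ≡ 3 → + 32 ∣ pbar 7 M
  32∣pbar M≡3 = let r , eq = pbar-coefficient in subst (+ 32 ∣_) (sym eq)
    (32∣expansion ((s ^ 3) M) ((s ^ 4) M) ((s ^ 5) M) r (constant-vanishes 3 M≡3 λ ())
      (s¹≡0 (%8⇒%4 M 3 M≡3) (λ ()) (λ ())) (s²≡0 (%8⇒%4 M 3 M≡3)))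

  128∣pbar : M % 8 ≡ 7 → + 128 ∣ pbar 7 M
  128∣pbar M≡7 = let r , eq = pbar-coefficient in subst (+ 128 ∣_) (sym eq)
    (128∣expansion r (constant-vanishes 7 M≡7 λ ()) (s¹≡0 M≡3 (λ ()) (λ ())) (s²≡0 M≡3) (s³≡0 M≡7)
      (s⁴≡4*x M≡3) (s⁵≡2*x M≡3))
    where
    M≡3 = %8⇒%4 M 7 M≡7

-- The five residue classes modulo 8

residue : ∀ n r → (8 * n + r) % 8 ≡ r % 8
residue n r = trans (cong (_% 8) (trans (ℕ.+-comm (8 * n) r) (cong (λ k → r + k) (ℕ.*-comm 8 n))))
                    ([m+kn]%n≡m%n r n 8)

theorem1p2 : (n : ℕ) →
    ((+ 2) ∣ pbar 7 (8 * n + 1)) ×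
    ((+ 16) ∣ pbar 7 (8 * n + 2)) ×
    ((+ 32) ∣ pbar 7 (8 * n + 3)) ×
    ((+ 2) ∣ pbar 7 (8 * n + 4)) ×
    ((+ 128) ∣ pbar 7 (8 * n + 7))
theorem1p2 n =
    -- In each component the truncation degree is the degree of the coefficient in question.
    Coefficient.2∣pbar (8 * n + 1) 1 (residue n 1) (λ ())
  , Coefficient.16∣pbar (8 * n + 2) (residue n 2)
  , Coefficient.32∣pbar (8 * n + 3) (residue n 3)
  , Coefficient.2∣pbar (8 * n + 4) 4 (residue n 4) (λ ())
  , Coefficient.128∣pbar (8 * n + 7) (residue n 7)
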